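{- Let $\langle O,\sqsubseteq,\triangleleft\rangle$ be a directed observation structure over a set $\mathbb{B}$ and let $P\subseteq\mathbb{B}$ be a property. Then for every $o\in O$ there is $o'\in O$ such that $o\sqsubseteq o'$ and $\widehat{\mathcal{M}}_P(o')\in\{\mathsf{yes},\mathsf{no},\chi\}$.
   Context: Let $\mathbb{B}$ be a set (of behaviours). A property is a subset $P\subseteq\mathbb{B}$. An observation structure over $\mathbb{B}$ is a preordered set $\langle O,\sqsubseteq\rangle$ (of observations) together with a relation $\triangleleft\subseteq O\times\mathbb{B}$ such that: (i) $o\sqsubseteq o'$ and $o'\triangleleft b$ imply $o\triangleleft b$; (ii) for every $o\in O$ there is $b\in\mathbb{B}$ with $o\triangleleft b$. It is directed if for all $o,o'\in O$ and $b\in\mathbb{B}$ with $o\triangleleft b$ and $o'\triangleleft b$ there is $o''\in O$ with $o''\triangleleft b$, $o\sqsubseteq o''$ and $o'\sqsubseteq o''$. Put $\mathbb{B}(o)=\{b\in\mathbb{B}\mid o\triangleleft b\}$. The abstract monitor of $P$ is the function $\mathcal{M}_P:O\to\{\mathsf{yes},\mathsf{no},\mathsf{?}\}$ with $\mathcal{M}_P(o)=\mathsf{yes}$ if $\mathbb{B}(o)\subseteq P$, $\mathcal{M}_P(o)=\mathsf{no}$ if $\mathbb{B}(o)\cap P=\emptyset$, and $\mathcal{M}_P(o)=\mathsf{?}$ otherwise. $P$ is a safety property if for every $b\in\mathbb{B}\setminus P$ there is $o\in O$ with $o\triangleleft b$ and $\mathcal{M}_P(o)=\mathsf{no}$; $P$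 is a cosafety property if for every $b\in P$ there is $o\in O$ with $o\triangleleft b$ and $\mathcal{M}_P(o)=\mathsf{yes}$. Let $\mathbb{S}$ and $\mathsf{co}\mathbb{S}$ be the sets of all safety, respectively cosafety, properties over $\mathbb{B}$. Put $\Gamma_{\mathbb{S}}(P)=\bigcap\{Q\in\mathbb{S}\mid P\subseteq Q\}$ and $\Delta_{\mathsf{co}\mathbb{S}}(P)=\bigcup\{Q\in\mathsf{co}\mathbb{S}\mid Q\subseteq P\}$. The generalised abstract monitor of $P$ is the function $\widehat{\mathcal{M}}_P:O\to\{\mathsf{yes},\mathsf{no},\mathsf{?},\mathsf{?}_{\mathsf{yes}},\mathsf{?}_{\mathsf{no}},\chi\}$ defined, writing $s=\mathcal{M}_{\Gamma_{\mathbb{S}}(P)}(o)$ and $c=\mathcal{M}_{\Delta_{\mathsf{co}\mathbb{S}}(P)}(o)$, by: $\widehat{\mathcal{M}}_P(o)=\mathsf{yes}$ if $c=\mathsf{yes}$; $\mathsf{no}$ if $s=\mathsf{no}$; $\chi$ if $s=\mathsf{yes}$ and $c=\mathsf{no}$; $\mathsf{?}_{\mathsf{yes}}$ if $s=\mathsf{yes}$ and $c=\mathsf{?}$; $\mathsf{?}_{\mathsf{no}}$ if $s=\mathsf{?}$ and $c=\mathsf{no}$; $\mathsf{?}$ if $s=\mathsf{?}$ and $c=\mathsf{?}$. (These cases are exhaustive and mutually exclusive since $\Delta_{\mathsf{co}\mathbb{S}}(P)\subseteq P\subseteq\Gamma_{\mathbb{S}}(P)$.) -}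

module Defs where

open import Axiom.ExcludedMiddle using (ExcludedMiddle)
open import Data.Bool.Base using (if_then_else_)
open import Data.Product.Base using (_×_; ∃-syntax)
open import Level using (Level; Setω; _⊔_) renaming (suc to lsuc)
open import Relation.Binary.Core using (Rel; REL)
open import Relation.Binary.PropositionalEquality.Core using (_≡_)
open import Relation.Binary.Structures using (IsPreorder)
open import Relation.Nullary.Decidable.Core using (does)
open import Relation.Unary using (Pred; _∈_; _∉_; _⊆_; _∩_; Empty)

private
  variable
    b o r t p : Level

-- The monitors below are total functions that decide arbitrary
-- propositions, so classical logic is taken as an explicit hypothesis.
Classical : Setω
Classical = ∀ {ℓ} → ExcludedMiddle ℓ

record ObservationStructure (𝔹 : Set b) o r t
       : Set (b ⊔ lsuc (o ⊔ r ⊔ t)) where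
  infix 4 _⊑_ _◁_
  field
    O          : Set o
    _⊑_        : Rel O r
    isPreorder : IsPreorder _≡_ _⊑_
    _◁_        : REL O 𝔹 t
    ◁-anti     : ∀ {x y β} → x ⊑ y → y ◁ β → x ◁ β
    ◁-total    : ∀ x → ∃[ β ] x ◁ β

  Directed : Set (b ⊔ o ⊔ r ⊔ t)
  Directed = ∀ {x y β} → x ◁ β → y ◁ β →
             ∃[ z ] (z ◁ β × x ⊑ z × y ⊑ z)

  𝔹⟨_⟩ : O → Pred 𝔹 t
  𝔹⟨ x ⟩ β = x ◁ β

data Verdict : Set where
  yes no unknown : Verdict

data GenVerdict : Set where
  yes no unknown unknown-yes unknown-no χ : GenVerdict

module Monitors (em : Classical) {𝔹 : Set b}
                (𝒪 : ObservationStructure 𝔹 o r t) where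
  open ObservationStructure 𝒪

  -- The two tests exclude each other because 𝔹⟨ x ⟩ is inhabited, so
  -- their order is immaterial.
  𝓜 : Pred 𝔹 p → O → Verdict
  𝓜 P x =
    if does (em {P = 𝔹⟨ x ⟩ ⊆ P}) then yes
    else if does (em {P = Empty (𝔹⟨ x ⟩ ∩ P)}) then no
    else unknown

  Safety : Pred (Pred 𝔹 p) (b ⊔ o ⊔ t ⊔ p)
  Safety P = ∀ {β} → β ∉ P → ∃[ x ] (x ◁ β × 𝓜 P x ≡ no)

  Cosafety : Pred (Pred 𝔹 p) (b ⊔ o ⊔ t ⊔ p)
  Cosafety P = ∀ {β} → β ∈ P → ∃[ x ] (x ◁ β × 𝓜 P x ≡ yes)

  -- Q ranges over the properties at the level of P, which raises the level
  -- of the result. This loses no properties: by `em`, every predicate on 𝔹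
  -- is extensionally equal to one at any given level.
  Γ-𝕊 : Pred 𝔹 p → Pred 𝔹 (b ⊔ o ⊔ t ⊔ lsuc p)
  Γ-𝕊 {p = p} P β = (Q : Pred 𝔹 p) → Q ∈ Safety → P ⊆ Q → β ∈ Q

  Δ-co𝕊 : Pred 𝔹 p → Pred 𝔹 (b ⊔ o ⊔ t ⊔ lsuc p)
  Δ-co𝕊 {p = p} P β = ∃[ Q ] (Q ∈ Cosafety {p = p} × Q ⊆ P × β ∈ Q)

  -- First argument: verdict for Γ-𝕊 P; second: verdict for Δ-co𝕊 P.
  -- The pair (no , yes) matches the first clause but never arises, since
  -- Δ-co𝕊 P ⊆ Γ-𝕊 P and 𝔹⟨ x ⟩ is inhabited.
  combine : Verdict → Verdict → GenVerdict
  combine _       yes     = yes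
  combine no      _       = no
  combine yes     no      = χ
  combine yes     unknown = unknown-yes
  combine unknown no      = unknown-no
  combine unknown unknown = unknown

  𝓜̂ : Pred 𝔹 p → O → GenVerdict
  𝓜̂ P x = combine (𝓜 (Γ-𝕊 P) x) (𝓜 (Δ-co𝕊 P) x)

{-# OPTIONS --safe #-}

-- Either every behaviour compatible with x lies in the safety closure Γ, or
-- some β with x ◁ β lies outside a safety property Q ⊇ P; directedness then merges x
-- with an observation of β refuting Q, which refutes Γ as well. In the first
-- case, either no behaviour compatible with x lies in the cosafety interior Δ,
-- and the verdict at x itself is χ, or dually x extends to an observation
-- verifying Δ.
module Submission where

open import Data.Empty using (⊥-elim)
open import Data.Product using (_×_; _,_; ∃-syntax)
open import Data.Sum using (_⊎_; inj₁; inj₂)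
open import Level using (Level)
open import Relation.Binary.PropositionalEquality using (_≡_; refl; cong₂)
open import Relation.Binary.Structures using (IsPreorder)
open import Relation.Nullary using () renaming (yes to holds; no to fails)
open import Relation.Nullary.Decidable using (decidable-stable)
open import Relation.Unary using (Pred; _∈_; _∉_; _⊆_; _∩_; Empty)
open import Defs

module MonitorProperties
  (em : Classical) {b o r t : Level} {𝔹 : Set b}
  (𝒪 : ObservationStructure 𝔹 o r t) where

  open ObservationStructure 𝒪
  open Monitors em 𝒪

  private
    variable
      p : Level
      x : O
      β : 𝔹

  𝓜-yes : (P : Pred 𝔹 p) → 𝔹⟨ x ⟩ ⊆ P → 𝓜 P x ≡ yes
  𝓜-yes {x = x} P x⊆P with em {P = 𝔹⟨ x ⟩ ⊆ P}
  ... | holds _  = refl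
  ... | fails x⊈P = ⊥-elim (x⊈P x⊆P)

  𝓜-yes⁻ : (P : Pred 𝔹 p) → 𝓜 P x ≡ yes → 𝔹⟨ x ⟩ ⊆ P
  𝓜-yes⁻ {x = x} P eq with em {P = 𝔹⟨ x ⟩ ⊆ P}
  ... | holds x⊆P = x⊆P
  ... | fails _ with em {P = Empty (𝔹⟨ x ⟩ ∩ P)} | eq
  ...   | holds _ | ()
  ...   | fails _  | ()

  𝓜-no : (P : Pred 𝔹 p) → Empty (𝔹⟨ x ⟩ ∩ P) → 𝓜 P x ≡ no
  𝓜-no {x = x} P x∩P=∅ with em {P = 𝔹⟨ x ⟩ ⊆ P}
  -- The tests exclude each other: `◁-total` supplies a behaviour of `x`, which would lie in the
  -- empty intersection.
  ... | holds x⊆P = let β , x◁β = ◁-total x in ⊥-elim (x∩P=∅ β (x◁β , x⊆P x◁β))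
  ... | fails _ with em {P = Empty (𝔹⟨ x ⟩ ∩ P)}
  ...   | holds _ = refl
  ...   | fails ¬∅ = ⊥-elim (¬∅ x∩P=∅)

  𝓜-no⁻ : (P : Pred 𝔹 p) → 𝓜 P x ≡ no → Empty (𝔹⟨ x ⟩ ∩ P)
  𝓜-no⁻ {x = x} P eq with em {P = 𝔹⟨ x ⟩ ⊆ P} | eq
  ... | holds _ | ()
  ... | fails _  | eq′ with em {P = Empty (𝔹⟨ x ⟩ ∩ P)} | eq′
  ...   | holds x∩P=∅ | _ = x∩P=∅
  ...   | fails _      | ()

  Γ-𝕊-refute : Directed → (P Q : Pred 𝔹 p) → Q ∈ Safety → P ⊆ Q →
               x ◁ β → β ∉ Q → ∃[ y ] (x ⊑ y × 𝓜 (Γ-𝕊 P) y ≡ no)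
  Γ-𝕊-refute directed P Q Q-safe P⊆Q x◁β β∉Q =
    let z , z◁β , 𝓜z≡no = Q-safe β∉Q
        y , _ , x⊑y , z⊑y = directed x◁β z◁β
    -- By `◁-anti`, behaviours compatible with `y` are compatible with `z`; as `Γ-𝕊 P` lies inside
    -- `Q`, the refutation at `z` carries over.
    in y , x⊑y , 𝓜-no (Γ-𝕊 P) λ γ (y◁γ , γ∈Γ) →
         𝓜-no⁻ Q 𝓜z≡no γ (◁-anti z⊑y y◁γ , γ∈Γ Q Q-safe P⊆Q)

  Δ-co𝕊-verify : Directed → (P : Pred 𝔹 p) → x ◁ β → β ∈ Δ-co𝕊 P →
                 ∃[ y ] (x ⊑ y × 𝓜 (Δ-co𝕊 P) y ≡ yes)
  Δ-co𝕊-verify directed P x◁β (Q , Q-cosafe , Q⊆P , β∈Q) =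
    let z , z◁β , 𝓜z≡yes = Q-cosafe β∈Q
        y , _ , x⊑y , z⊑y = directed x◁β z◁β
    -- Dually, `Q` is one of the sets whose union is `Δ-co𝕊 P`.
    in y , x⊑y , 𝓜-yes (Δ-co𝕊 P) λ y◁γ →
         Q , Q-cosafe , Q⊆P , 𝓜-yes⁻ Q 𝓜z≡yes (◁-anti z⊑y y◁γ)

  Conclusive : GenVerdict → Set
  Conclusive v = v ≡ yes ⊎ v ≡ no ⊎ v ≡ χ

  -- `combine` inspects `c` first, so `c` is split; even the pair (`no`, `yes`), which the monitors
  -- never produce, comes out conclusive.
  combine-no : ∀ {s} c → s ≡ no → Conclusive (combine s c)
  combine-no yes     refl = inj₁ refl
  combine-no no      refl = inj₂ (inj₁ refl)
  combine-no unknown refl = inj₂ (inj₁ refl)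

  combine-yes : ∀ s {c} → c ≡ yes → Conclusive (combine s c)
  combine-yes _ refl = inj₁ refl

  conclusive-extension : Directed → (P : Pred 𝔹 p) → ∀ x →
                         ∃[ y ] (x ⊑ y × Conclusive (𝓜̂ P y))
  conclusive-extension {p = p} directed P x
    -- Non-membership in `Γ-𝕊 P` is put in positive form, naming the `Q` that excludes `β`, so that
    -- `em` itself yields the witness.
    with em {P = ∃[ β ] ∃[ Q ] (x ◁ β × Q ∈ Safety {p = p} × P ⊆ Q × β ∉ Q)}
  ... | holds (β , Q , x◁β , Q-safe , P⊆Q , β∉Q) =
    let y , x⊑y , s≡no = Γ-𝕊-refute directed P Q Q-safe P⊆Q x◁β β∉Q
    in y , x⊑y , combine-no (𝓜 (Δ-co𝕊 P) y) s≡no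
  ... | fails irrefutable with em {P = ∃[ β ] (x ◁ β × β ∈ Δ-co𝕊 P)}
  ...   | holds (β , x◁β , β∈Δ) =
    let y , x⊑y , c≡yes = Δ-co𝕊-verify directed P x◁β β∈Δ
    in y , x⊑y , combine-yes (𝓜 (Γ-𝕊 P) y) c≡yes
  ...   | fails x∩Δ=∅ =
    x , IsPreorder.refl isPreorder , inj₂ (inj₂ (cong₂ combine s≡yes c≡no))
    where
    s≡yes : 𝓜 (Γ-𝕊 P) x ≡ yes
    s≡yes = 𝓜-yes (Γ-𝕊 P) λ {β} x◁β Q Q-safe P⊆Q →
      -- `irrefutable` only shows that `β` is not outside `Q`; classical logic turns this into
      -- membership.
      decidable-stable em λ β∉Q →
        irrefutable (β , Q , x◁β , (λ {γ} → Q-safe {γ}) , P⊆Q , β∉Q)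

    c≡no : 𝓜 (Δ-co𝕊 P) x ≡ no
    c≡no = 𝓜-no (Δ-co𝕊 P) λ β β∈x∩Δ → x∩Δ=∅ (β , β∈x∩Δ)

theorem2 :
    (em : Classical) →
    ∀ {b o r t p : Level} {𝔹 : Set b} (𝒪 : ObservationStructure 𝔹 o r t) →
    let open ObservationStructure 𝒪
        open Monitors em 𝒪 in
    Directed → (P : Pred 𝔹 p) →
    ∀ (x : O) → ∃[ y ] (x ⊑ y × (𝓜̂ P y ≡ yes ⊎ 𝓜̂ P y ≡ no ⊎ 𝓜̂ P y ≡ χ))
theorem2 em 𝒪 = MonitorProperties.conclusive-extension em 𝒪
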